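{- Let $c = \log_2(3+\sqrt{10}) \approx 2.623$. There is a constant $C>0$ such that for every $n \in \mathbb{N}$ there exists an outerplanar graph on at most $C n^{c}$ vertices that contains every tree on $n$ vertices as a subgraph.
   Context: A graph $H$ contains $G$ as a subgraph if there is an injective map $V(G)\to V(H)$ sending edges of $G$ to edges of $H$ (the subgraph need not be induced). -}

module Defs where

open import Data.Nat using (ℕ; zero; suc; _+_; _*_; _∸_; _^_; _≤_; _<_)
open import Data.Fin using (Fin; zero; suc; inject₁; fromℕ)
open import Data.Product using (Σ; ∃; ∃-syntax; _×_; _,_)
open import Relation.Binary.PropositionalEquality using (_≡_)
open import Relation.Nullary using (¬_)
open import Function.Definitions using (Injective)
open import Data.Fin.Base using () renaming (_<_ to _<ᶠ_)

record SimpleGraph (n : ℕ) : Set₁ where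
  field
    Adj     : Fin n → Fin n → Set
    sym     : ∀ {u v} → Adj u v → Adj v u
    irrefl  : ∀ {u} → ¬ Adj u u
open SimpleGraph public

Contains : ∀ {m n} → SimpleGraph m → SimpleGraph n → Set
Contains {m} {n} H G =
  Σ (Fin n → Fin m) λ f → Injective _≡_ _≡_ f ×
    (∀ u v → Adj G u v → Adj H (f u) (f v))

data Reach {n} (G : SimpleGraph n) : Fin n → Fin n → Set where
  here : ∀ {u} → Reach G u u
  step : ∀ {u v w} → Adj G u v → Reach G v w → Reach G u w

Connected : ∀ {n} → SimpleGraph n → Set
Connected G = ∀ u v → Reach G u v

HasCycle : ∀ {n} → SimpleGraph n → Set
HasCycle {n} G = ∃[ k ] Σ (Fin (3 + k) → Fin n) λ v →
  Injective _≡_ _≡_ v ×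
  (∀ (i : Fin (2 + k)) → Adj G (v (inject₁ i)) (v (suc i))) ×
  Adj G (v (fromℕ (2 + k))) (v zero)

Acyclic : ∀ {n} → SimpleGraph n → Set
Acyclic G = ¬ HasCycle G

IsTree : ∀ {n} → SimpleGraph n → Set
IsTree G = Connected G × Acyclic G

-- Outerplanar: the vertices can be placed in convex position (cyclic order
-- given by a bijection pos : Fin m → Fin m) so that no two edges cross as
-- chords, i.e. there are no edges uv, xy with pos u < pos x < pos v < pos y.
Outerplanar : ∀ {m} → SimpleGraph m → Set
Outerplanar {m} H = Σ (Fin m → Fin m) λ pos → Injective _≡_ _≡_ pos ×
  (∀ u v x y → Adj H u v → Adj H x y →
     ¬ (pos u <ᶠ pos x × pos x <ᶠ pos v × pos v <ᶠ pos y))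

-- The bound m ≤ C · n^c with c = log₂(3 + √10), in integer arithmetic.
-- (3 + √10)^q = A q + B q · √10 with A, B natural numbers.

AB : ℕ → ℕ × ℕ
AB zero = 1 , 0
AB (suc q) with AB q
... | a , b = 3 * a + 10 * b , a + 3 * b

A B : ℕ → ℕ
A q with AB q
... | a , _ = a
B q with AB q
... | _ , b = b

-- p / q > c  ⇔  2^p > (3 + √10)^q  ⇔  A q < 2^p  and  10·(B q)² < (2^p − A q)²
AboveC : ℕ → ℕ → Set
AboveC p q = A q < 2 ^ p × 10 * (B q ^ 2) < (2 ^ p ∸ A q) ^ 2

-- m ≤ C · n^c  ⇔  for every rational r = p/q > c (q ≥ 1), m ≤ C · n^r,
-- i.e. m^q ≤ C^q · n^p.
BoundedBy : ℕ → ℕ → ℕ → Set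
BoundedBy C n m = ∀ p q → 1 ≤ q → AboveC p q → m ^ q ≤ C ^ q * n ^ p

{-# OPTIONS --safe --termination-depth=2 #-}

-- The host graph is a triangulated polygon with O(6^k) vertices, where
-- 2^k ≥ n; since 6 < 3 + √10 this is within the required bound.  It is built
-- from three kinds of pieces, each doubling the weight it can absorb from level
-- k to level k + 1:
--
--   * bush k has one distinguished vertex s and contains every rooted forest of
--     weight < 2^k hung below s;
--   * strip k sits on an edge st and contains every path from s to t whose inner
--     vertices, with the trees hanging from them, weigh < 2^k: a weighted
--     median of the path goes to the apex over st, and both halves recurse;
--   * fan k only adds smaller bushes at s, so that a strip k which is not needed
--     for a path can instead hold a forest of weight < 2^k below s.
--
-- For a forest of weight < 2h below s, cut its list of trees where the running
-- weight first reaches h.  If the tree at the cut weighs less than h, its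
-- root goes to the apex t, and the trees before and after the cut go to a bush
-- and to the strip with its fan.  Otherwise follow the path of vertices whose
-- subtree weighs at least h; its end goes to t, its inner part (weight < h) to
-- the strip, everything else at s to a bush, and the forest below t, made of
-- trees of weight < h, fits into three bushes at t.

module Submission where

open import Defs hiding (A; B) renaming (sym to Adj-sym)
open import Data.Nat using (ℕ; zero; suc; _+_; _*_; _∸_; _^_; _≤_; _<_; z≤n; s≤s; z<s; _<?_; _≤?_)
open import Data.Nat.Properties
open import Data.Nat.Tactic.RingSolver using (solve-∀)
open import Data.Fin using (Fin; zero; suc; toℕ; fromℕ<; fromℕ; inject₁)
import Data.Fin as Fin
open import Data.Fin.Properties using (fromℕ<-injective; toℕ-fromℕ<; injective⇒≤)
open import Data.Product using (Σ; ∃-syntax; _×_; _,_; proj₁; proj₂)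
open import Data.Product.Properties using (≡-dec; ,-injectiveˡ)
open import Data.Sum using (_⊎_; inj₁; inj₂; [_,_]′; swap)
open import Data.List using (List; []; _∷_; _++_; [_]; map; length; lookup; allFin)
open import Data.List.Properties using (++-assoc; ++-identityʳ; map-++; length-++)
open import Data.List.Membership.Propositional using (_∈_)
open import Data.List.Membership.Propositional.Properties using (∈-++⁺ˡ; ∈-++⁺ʳ; ∈-++⁻; ∈-lookup; ∈-map⁻; ∈-allFin)
import Data.List.Membership.DecPropositional as DecMembership
open import Data.List.Relation.Unary.Any using (here; there)
open import Data.List.Relation.Unary.All as All using (All; []; _∷_)
import Data.List.Relation.Unary.All.Properties as All
open import Data.List.Relation.Unary.AllPairs using (AllPairs; []; _∷_)
import Data.List.Relation.Unary.AllPairs.Properties as AllPairs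
open import Data.List.Relation.Unary.Unique.Propositional using (Unique)
open import Data.List.Relation.Binary.Subset.Propositional using (_⊆_)
import Data.List.Relation.Binary.Subset.Propositional.Properties as ⊆
open import Data.List.Relation.Binary.Permutation.Propositional using (_↭_; ↭-refl; ↭-sym; ↭-trans; ↭-prep; ↭-swap; ↭-reflexive; ↭⇒↭ₛ)
open import Data.List.Relation.Binary.Permutation.Propositional.Properties as Perm using (∈-resp-↭; ++-commutativeMonoid)
import Data.List.Relation.Binary.Permutation.Setoid.Properties as PermSetoid
import Algebra.Solver.CommutativeMonoid as CommutativeMonoidSolver
open import Function using (_∘_; id)
open import Function.Definitions using (Injective)
open import Relation.Nullary using (yes; no; ¬_; contradiction)
open import Relation.Nullary.Decidable using (_⊎-dec_)
open import Relation.Binary.PropositionalEquality using (_≡_; _≢_; refl; sym; trans; cong; cong₂; subst; subst₂; setoid)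

-- Triangulated polygons

-- A polygon triangulated on one side of a base edge: tri l r is the triangle over
-- the base, with l and r glued to its two other sides.  The corners are
-- numbered from left to right: a gadget whose base starts at a ends at a + width.
data Gadget : Set where
  edge : Gadget
  tri  : Gadget → Gadget → Gadget

width : Gadget → ℕ
width edge      = 1
width (tri l r) = width l + width r

-- The right end of `base` is fixed by an equation rather than an index, so matching on two chords
-- of the same gadget never has to unify sums.
data Chord : Gadget → ℕ → ℕ → ℕ → Set where
  base  : ∀ {g a v} → v ≡ a + width g → Chord g a a v
  left  : ∀ {l r a u v} → Chord l a u v → Chord (tri l r) a u v
  right : ∀ {l r a u v} → Chord r (a + width l) u v → Chord (tri l r) a u v

0<width : ∀ g → 0 < width g
0<width edge      = z<s
0<width (tri l r) = <-≤-trans (0<width l) (m≤m+n _ _)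

Chord-lower : ∀ {g a u v} → Chord g a u v → a ≤ u
Chord-lower (base _)          = ≤-refl
Chord-lower (left c)          = Chord-lower c
Chord-lower {a = a} (right c) = ≤-trans (m≤m+n a _) (Chord-lower c)

Chord-upper : ∀ {g a u v} → Chord g a u v → v ≤ a + width g
Chord-upper (base refl)               = ≤-refl
Chord-upper {a = a} (left c)          = ≤-trans (Chord-upper c) (+-monoʳ-≤ a (m≤m+n _ _))
Chord-upper {a = a} (right {l} {r} c) =
  ≤-trans (Chord-upper c) (≤-reflexive (+-assoc a (width l) (width r)))

Chord-increasing : ∀ {g a u v} → Chord g a u v → u < v
Chord-increasing {g} {a} (base refl) = m<m+n a (0<width g)
Chord-increasing (left c)            = Chord-increasing c
Chord-increasing (right c)           = Chord-increasing c

-- No chord leaves the interval spanned by the base, and the intervals of the two sides share only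
-- the apex.
Chord-noncrossing : ∀ {g a u v x y} → Chord g a u v → Chord g a x y →
                    u < x → x < v → ¬ v < y
Chord-noncrossing (base refl) d           _   _   v<y = <⇒≱ v<y (Chord-upper d)
Chord-noncrossing c           (base refl) u<x _   _   = <⇒≱ u<x (Chord-lower c)
Chord-noncrossing (left c)    (left d)    u<x x<v v<y = Chord-noncrossing c d u<x x<v v<y
Chord-noncrossing (right c)   (right d)   u<x x<v v<y = Chord-noncrossing c d u<x x<v v<y
Chord-noncrossing (left c)    (right d)   _   x<v _   =
  <⇒≱ x<v (≤-trans (Chord-upper c) (Chord-lower d))
Chord-noncrossing (right c)   (left d)    u<x x<v v<y =
  <⇒≱ (<-trans u<x (<-trans x<v v<y)) (≤-trans (Chord-upper d) (Chord-lower c))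

-- bush, strip and fan take the gadget X that occupies their leftmost side, next to
-- the left end of the base; several pieces can thus be stacked at one vertex.
mutual
  bush : ℕ → Gadget → Gadget
  bush zero    X = X
  bush (suc k) X = tri (strip k (fan k (bush k X))) (bush k (bush k (bush k edge)))

  strip : ℕ → Gadget → Gadget
  strip zero    X = X
  strip (suc k) X = tri (strip k X) (strip k (bush (suc k) edge))

  fan : ℕ → Gadget → Gadget
  fan zero    X = X
  fan (suc k) X = fan k (bush k X)

-- Width bounds

mutual
  -- The coefficients 5, 8 and 1 solve the mutual recursion with growth rate 6: 30 = 8 + 1 + 4 * 5 +
  -- 1, 48 ≥ 2 * 8 + 30 + 1 and 6 = 1 + 5. The summand 1 is the `edge` at the apex, absorbed through
  -- `1 ≤ 6 ^ k`.
  width-bush : ∀ k X → width (bush k X) ≤ width X + 5 * 6 ^ k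
  width-bush zero    X = m≤m+n _ _
  width-bush (suc k) X = begin
    width (strip k (fan k (bush k X))) + width (bush k (bush k (bush k edge)))
      ≤⟨ +-mono-≤ (≤-trans (width-strip k _) (+-monoˡ-≤ _
           (≤-trans (width-fan k _) (+-monoˡ-≤ _ (width-bush k X)))))
         (≤-trans (width-bush k _) (+-monoˡ-≤ _
           (≤-trans (width-bush k _) (+-monoˡ-≤ _ (width-bush k edge))))) ⟩
    (width X + 5 * P + P + 8 * P) + (1 + 5 * P + 5 * P + 5 * P)
      ≤⟨ +-monoʳ-≤ (width X + 5 * P + P + 8 * P)
           (+-monoˡ-≤ _ (+-monoˡ-≤ _ (+-monoˡ-≤ (5 * P) (m^n>0 6 k)))) ⟩
    (width X + 5 * P + P + 8 * P) + (P + 5 * P + 5 * P + 5 * P)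
      ≡⟨ total (width X) P ⟩
    width X + 5 * 6 ^ suc k ∎
    where
    open ≤-Reasoning
    P = 6 ^ k
    total : ∀ w P → (w + 5 * P + P + 8 * P) + (P + 5 * P + 5 * P + 5 * P) ≡ w + 5 * (6 * P)
    total = solve-∀

  width-strip : ∀ k X → width (strip k X) ≤ width X + 8 * 6 ^ k
  width-strip zero    X = m≤m+n _ _
  width-strip (suc k) X = begin
    width (strip k X) + width (strip k (bush (suc k) edge))
      ≤⟨ +-mono-≤ (width-strip k X) (≤-trans (width-strip k _)
           (+-monoˡ-≤ _ (width-bush (suc k) edge))) ⟩
    (width X + 8 * P) + (1 + 5 * (6 * P) + 8 * P)
      ≤⟨ +-monoʳ-≤ (width X + 8 * P) (+-monoˡ-≤ (8 * P)
           (+-monoˡ-≤ (5 * (6 * P)) (≤-trans (m^n>0 6 k) (m≤m+n P P)))) ⟩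
    (width X + 8 * P) + (P + P + 5 * (6 * P) + 8 * P)
      ≡⟨ total (width X) P ⟩
    width X + 8 * 6 ^ suc k ∎
    where
    open ≤-Reasoning
    P = 6 ^ k
    total : ∀ w P → (w + 8 * P) + (P + P + 5 * (6 * P) + 8 * P) ≡ w + 8 * (6 * P)
    total = solve-∀

  width-fan : ∀ k X → width (fan k X) ≤ width X + 6 ^ k
  width-fan zero    X = m≤m+n _ _
  width-fan (suc k) X = begin
    width (fan k (bush k X))  ≤⟨ ≤-trans (width-fan k _) (+-monoˡ-≤ _ (width-bush k X)) ⟩
    width X + 5 * P + P       ≡⟨ total (width X) P ⟩
    width X + 6 ^ suc k       ∎
    where
    open ≤-Reasoning
    P = 6 ^ k
    total : ∀ w P → w + 5 * P + P ≡ w + 6 * P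
    total = solve-∀

-- X ≼ Y: X is glued into Y along the left end, so both start at the same vertex.
infix 4 _≼_
data _≼_ (X : Gadget) : Gadget → Set where
  ≼-refl : X ≼ X
  ≼-tri  : ∀ {l r} → X ≼ l → X ≼ tri l r

≼-trans : ∀ {X Y Z} → X ≼ Y → Y ≼ Z → X ≼ Z
≼-trans p ≼-refl    = p
≼-trans p (≼-tri q) = ≼-tri (≼-trans p q)

≼-width : ∀ {X Y} → X ≼ Y → width X ≤ width Y
≼-width ≼-refl    = ≤-refl
≼-width (≼-tri p) = ≤-trans (≼-width p) (m≤m+n _ _)

≼-Chord : ∀ {X Y a u v} → X ≼ Y → Chord X a u v → Chord Y a u v
≼-Chord ≼-refl    c = c
≼-Chord (≼-tri p) c = left (≼-Chord p c)

mutual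
  ≼-bush : ∀ k X → X ≼ bush k X
  ≼-bush zero    X = ≼-refl
  ≼-bush (suc k) X = ≼-tri (≼-trans (≼-bush k X) (≼-trans (≼-fan k _) (≼-strip k _)))

  ≼-strip : ∀ k X → X ≼ strip k X
  ≼-strip zero    X = ≼-refl
  ≼-strip (suc k) X = ≼-tri (≼-strip k X)

  ≼-fan : ∀ k X → X ≼ fan k X
  ≼-fan zero    X = ≼-refl
  ≼-fan (suc k) X = ≼-trans (≼-bush k X) (≼-fan k _)

-- Rooted forests

module _ {V : Set} where

  data Forest : Set where
    ∅    : Forest
    tree : (v : V) (children rest : Forest) → Forest

  infixr 5 _∪_
  _∪_ : Forest → Forest → Forest
  ∅          ∪ G = G
  tree v c F ∪ G = tree v c (F ∪ G)

  size : Forest → ℕ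
  size ∅            = 0
  size (tree v c F) = suc (size c) + size F

  labels : Forest → List V
  labels ∅            = []
  labels (tree v c F) = v ∷ labels c ++ labels F

  edges : V → Forest → List (V × V)
  edges p ∅            = []
  edges p (tree v c F) = (p , v) ∷ edges v c ++ edges p F

  -- The same data read as a path from p to q whose inner vertices are the roots.
  spine : V → Forest → V → List (V × V)
  spine p ∅            q = [ p , q ]
  spine p (tree v c F) q = (p , v) ∷ edges v c ++ spine v F q

  size-∪ : ∀ F G → size (F ∪ G) ≡ size F + size G
  size-∪ ∅            G = refl
  size-∪ (tree v c F) G = trans (cong (suc (size c) +_) (size-∪ F G))
                                (sym (+-assoc (suc (size c)) (size F) (size G)))

  labels-∪ : ∀ F G → labels (F ∪ G) ≡ labels F ++ labels G
  labels-∪ ∅            G = refl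
  labels-∪ (tree v c F) G = cong (v ∷_) (trans (cong (labels c ++_) (labels-∪ F G))
                                               (sym (++-assoc (labels c) (labels F) (labels G))))

  edges-∪ : ∀ p F G → edges p (F ∪ G) ≡ edges p F ++ edges p G
  edges-∪ p ∅            G = refl
  edges-∪ p (tree v c F) G = cong ((p , v) ∷_) (trans (cong (edges v c ++_) (edges-∪ p F G))
                                          (sym (++-assoc (edges v c) (edges p F) (edges p G))))

  spine-∪ : ∀ p F v c G q →
            spine p (F ∪ tree v c G) q ≡ spine p F v ++ edges v c ++ spine v G q
  spine-∪ p ∅            v c G q = refl
  spine-∪ p (tree w d F) v c G q =
    cong ((p , w) ∷_) (trans (cong (edges w d ++_) (spine-∪ w F v c G q))
                             (sym (++-assoc (edges w d) (spine w F v) _)))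

  -- Cutting forests by weight

  data Split (h : ℕ) : Forest → Set where
    fits  : ∀ {F} → size F < h → Split h F
    split : ∀ A v c B → size A < h → h ≤ size A + suc (size c) → Split h (A ∪ tree v c B)

  splitAt : ∀ h F → 0 < h → Split h F
  splitAt h ∅            0<h = fits 0<h
  splitAt h (tree v c F) 0<h with suc (size c) <? h
  ... | no  ≥h = split ∅ v c F 0<h (≮⇒≥ ≥h)
  ... | yes <h with splitAt (h ∸ suc (size c)) F (m<n⇒0<n∸m <h)
  ...   | fits F<            = fits (subst (_< h) (+-comm (size F) _) (m≤o∸n⇒m+n≤o _ (<⇒≤ <h) F<))
  ...   | split A w d B A< ≥ = split (tree v c A) w d B
    (subst (_< h) (+-comm (size A) _) (m≤o∸n⇒m+n≤o _ (<⇒≤ <h) A<))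
    (≤-trans (m≤n+m∸n h (suc (size c))) (≤-trans (+-monoʳ-≤ (suc (size c)) ≥)
      (≤-reflexive (sym (+-assoc (suc (size c)) (size A) (suc (size d)))))))

x<2h⇒0<h : ∀ {x h} → x < 2 * h → 0 < h
x<2h⇒0<h {h = suc _} _ = z<s

remainder< : ∀ {h z} x {y} → h ≤ x → x + y ≡ z → z < 2 * h → y < h
remainder< {h} x {y} h≤x refl z<2h = +-cancelˡ-< h y h
  (≤-<-trans (+-monoˡ-≤ y h≤x) (subst (x + y <_) (cong (h +_) (+-identityʳ h)) z<2h))

module PermutationSolver (V : Set) where
  open module Labels = CommutativeMonoidSolver (++-commutativeMonoid {A = V}) public
    using () renaming (solve to solveᵛ; _⊜_ to _⊜ᵛ_; _⊕_ to infixr 5 _⊕ᵛ_; id to εᵛ)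
  open module Edges = CommutativeMonoidSolver (++-commutativeMonoid {A = V × V}) public
    using () renaming (solve to solveᵉ; _⊜_ to _⊜ᵉ_; _⊕_ to infixr 5 _⊕ᵉ_; id to εᵉ)

module _ {V : Set} where

  open PermutationSolver V

  labels-split : ∀ A (v : V) c B →
                 labels (A ∪ tree v c B) ↭ v ∷ (labels A ++ labels B) ++ labels c
  labels-split A v c B rewrite labels-∪ A (tree v c B) =
    solveᵛ 4 (λ a v c b → (a ⊕ᵛ v ⊕ᵛ c ⊕ᵛ b) ⊜ᵛ (v ⊕ᵛ (a ⊕ᵛ b) ⊕ᵛ c)) ↭-refl (labels A) [ v ] (labels c) (labels B)

  edges-split : ∀ p A (v : V) c B →
                edges p (A ∪ tree v c B) ↭ (p , v) ∷ (edges p A ++ edges p B) ++ edges v c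
  edges-split p A v c B rewrite edges-∪ p A (tree v c B) =
    solveᵉ 4 (λ a v c b → (a ⊕ᵉ v ⊕ᵉ c ⊕ᵉ b) ⊜ᵉ (v ⊕ᵉ (a ⊕ᵉ b) ⊕ᵉ c)) ↭-refl (edges p A) [ p , v ] (edges v c) (edges p B)

  size-split : ∀ A (v : V) c B → suc (size c) + (size A + size B) ≡ size (A ∪ tree v c B)
  size-split A v c B rewrite size-∪ A (tree v c B) = lemma (size A) (size c) (size B)
    where
    lemma : ∀ a c b → suc c + (a + b) ≡ a + (suc c + b)
    lemma = solve-∀

  split-rest< : ∀ {h} A (v : V) c B → h ≤ size A + suc (size c) → size (A ∪ tree v c B) < 2 * h → size B < h
  split-rest< A v c B h≤ = remainder< _ h≤
    (trans (+-assoc (size A) (suc (size c)) (size B)) (sym (size-∪ A (tree v c B))))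

  child< : ∀ A (v : V) c B → size c < size (A ∪ tree v c B)
  child< A v c B = ≤-trans (m≤m+n _ (size A + size B)) (≤-reflexive (size-split A v c B))

  -- The root at the cut is a weighted median: the trees before it weigh less than h by the choice
  -- of the cut, those after it because the total is below 2h. Its own children may weigh almost 2h,
  -- hence the `bush (suc k)` at the apex of a strip.
  centre : ∀ h (F : Forest {V}) → F ≢ ∅ → size F < 2 * h →
           ∃[ A ] ∃[ v ] ∃[ c ] ∃[ B ]
             (F ≡ A ∪ tree v c B × size A < h × size B < h × size c < 2 * h)
  centre h F F≢∅ F<2h with splitAt h F (x<2h⇒0<h F<2h)
  ... | split A v c B A<h h≤ =
    A , v , c , B , refl , A<h , split-rest< A v c B h≤ F<2h , <-trans (child< A v c B) F<2h
  ... | fits F<h = first F F≢∅ F<h F<2h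
    where
    first : ∀ F → F ≢ ∅ → size F < h → size F < 2 * h → ∃[ A ] ∃[ v ] ∃[ c ] ∃[ B ]
              (F ≡ A ∪ tree v c B × size A < h × size B < h × size c < 2 * h)
    first ∅            F≢∅ _   _    = contradiction refl F≢∅
    -- The whole forest is lighter than h, so any root would do.
    first (tree v c G) _   F<h F<2h =
      ∅ , v , c , G , refl , ≤-<-trans z≤n F<h , ≤-<-trans (m≤n+m (size G) _) F<h ,
      <-trans (child< ∅ v c G) F<2h

  -- The path from v through the subtrees of weight ≥ h, and below its end a forest
  -- in three parts of weight < h.
  record HeavyPath (h : ℕ) (v : V) (c : Forest) : Set where
    field
      inner    : Forest
      end      : V
      d₁ d₂ d₃ : Forest
      d₁<h     : size d₁ < h
      d₂<h     : size d₂ < h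
      d₃<h     : size d₃ < h
      inner≤   : h + size inner ≤ suc (size c)
      labels-↭ : v ∷ labels c ↭ end ∷ labels inner ++ labels d₁ ++ labels d₂ ++ labels d₃
      edges-↭  : ∀ p → (p , v) ∷ edges v c ↭
                       spine p inner end ++ edges end d₁ ++ edges end d₂ ++ edges end d₃

  -- Descends as long as some child has a subtree of weight at least h. The subtree at `end` is
  -- itself that heavy and disjoint from `inner`, which gives `inner≤`. The child comes out of
  -- `splitAt`, not from a pattern, so `fuel` bounds the descent.
  heavyPath : ∀ fuel {h} v c → size c < fuel → h ≤ suc (size c) → suc (size c) < 2 * h →
              HeavyPath h v c
  heavyPath (suc fuel) {h} v c (s≤s c≤fuel) h≤ <2h with splitAt h c (x<2h⇒0<h <2h)
  ... | fits c<h = record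
    { inner = ∅; end = v; d₁ = c; d₂ = ∅; d₃ = ∅
    ; d₁<h = c<h; d₂<h = ≤-<-trans z≤n c<h; d₃<h = ≤-<-trans z≤n c<h
    ; inner≤ = ≤-trans (≤-reflexive (+-identityʳ h)) h≤
    ; labels-↭ = ↭-reflexive (cong (v ∷_) (sym (++-identityʳ (labels c))))
    ; edges-↭ = λ p → ↭-reflexive (cong ((p , v) ∷_) (sym (++-identityʳ (edges v c)))) }
  ... | split A w d B A<h h≤A+d with suc (size d) <? h
  -- No child is heavy: the children before, at and after the cut each weigh less than h. This case
  -- is what requires three bushes at the apex.
  ...   | yes d<h = record
    { inner = ∅; end = v; d₁ = A; d₂ = tree w d ∅; d₃ = B
    ; d₁<h = A<h; d₂<h = subst (_< h) (sym (+-identityʳ _)) d<h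
    ; d₃<h = split-rest< A w d B h≤A+d (<-trans (n<1+n _) <2h)
    ; inner≤ = ≤-trans (≤-reflexive (+-identityʳ h)) h≤
    ; labels-↭ = ↭-prep v (↭-trans (labels-split A w d B)
        (solveᵛ 4 (λ a w d b → (w ⊕ᵛ (a ⊕ᵛ b) ⊕ᵛ d) ⊜ᵛ (a ⊕ᵛ (w ⊕ᵛ d ⊕ᵛ εᵛ) ⊕ᵛ b))
          ↭-refl (labels A) [ w ] (labels d) (labels B)))
    ; edges-↭ = λ p → ↭-prep (p , v) (↭-trans (edges-split v A w d B)
        (solveᵉ 4 (λ a w d b → (w ⊕ᵉ (a ⊕ᵉ b) ⊕ᵉ d) ⊜ᵉ (a ⊕ᵉ (w ⊕ᵉ d ⊕ᵉ εᵉ) ⊕ᵉ b))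
          ↭-refl (edges v A) [ v , w ] (edges w d) (edges v B))) }
  -- The path goes on through w; v becomes an inner vertex that keeps the other children.
  ...   | no d≮h = record
    { inner = tree v (A ∪ B) H.inner; end = H.end; d₁ = H.d₁; d₂ = H.d₂; d₃ = H.d₃
    ; d₁<h = H.d₁<h; d₂<h = H.d₂<h; d₃<h = H.d₃<h
    ; inner≤ = inner-bound
    ; labels-↭ = ↭-trans (↭-prep v (labels-split A w d B)) (↭-trans
        (solveᵛ 4 (λ v w ab d → (v ⊕ᵛ w ⊕ᵛ ab ⊕ᵛ d) ⊜ᵛ ((v ⊕ᵛ ab) ⊕ᵛ (w ⊕ᵛ d)))
          ↭-refl [ v ] [ w ] (labels A ++ labels B) (labels d)) (↭-trans
        (Perm.++⁺ˡ (v ∷ labels A ++ labels B) H.labels-↭) (↭-trans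
        (solveᵛ 5 (λ v ab e i d → ((v ⊕ᵛ ab) ⊕ᵛ (e ⊕ᵛ i ⊕ᵛ d)) ⊜ᵛ (e ⊕ᵛ (v ⊕ᵛ ab ⊕ᵛ i) ⊕ᵛ d))
          ↭-refl [ v ] (labels A ++ labels B) [ H.end ] (labels H.inner) _)
        (↭-reflexive (cong (λ ls → H.end ∷ (v ∷ ls ++ labels H.inner) ++ labels H.d₁ ++ labels H.d₂ ++ labels H.d₃) (sym (labels-∪ A B)))))))
    ; edges-↭ = λ p → ↭-trans (↭-prep (p , v) (edges-split v A w d B)) (↭-trans
        (solveᵉ 4 (λ v w ab d → (v ⊕ᵉ w ⊕ᵉ ab ⊕ᵉ d) ⊜ᵉ ((v ⊕ᵉ ab) ⊕ᵉ (w ⊕ᵉ d)))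
          ↭-refl [ p , v ] [ v , w ] (edges v A ++ edges v B) (edges w d)) (↭-trans
        (Perm.++⁺ˡ ((p , v) ∷ edges v A ++ edges v B) (H.edges-↭ v)) (↭-trans
        (solveᵉ 4 (λ v ab s d → ((v ⊕ᵉ ab) ⊕ᵉ (s ⊕ᵉ d)) ⊜ᵉ ((v ⊕ᵉ ab ⊕ᵉ s) ⊕ᵉ d))
          ↭-refl [ p , v ] (edges v A ++ edges v B) (spine v H.inner H.end) _)
        (↭-reflexive (cong (λ es → ((p , v) ∷ es ++ spine v H.inner H.end) ++ _) (sym (edges-∪ v A B)))))))
    }
    where
    d<c : suc (size d) ≤ size (A ∪ tree w d B)
    d<c = child< A w d B
    module H = HeavyPath (heavyPath fuel {h} w d (≤-trans d<c c≤fuel) (≮⇒≥ d≮h)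
      (≤-<-trans d<c (<-trans (n<1+n _) <2h)))
    inner-bound : h + (suc (size (A ∪ B)) + size H.inner) ≤ suc (size (A ∪ tree w d B))
    inner-bound = begin
      h + (suc (size (A ∪ B)) + size H.inner)    ≡⟨ rearrange h (size (A ∪ B)) (size H.inner) ⟩
      suc (h + size H.inner + size (A ∪ B))      ≤⟨ s≤s (+-monoˡ-≤ _ H.inner≤) ⟩
      suc (suc (size d) + size (A ∪ B))          ≡⟨ cong (λ s → suc (suc (size d) + s)) (size-∪ A B) ⟩
      suc (suc (size d) + (size A + size B))     ≡⟨ cong suc (size-split A w d B) ⟩
      suc (size (A ∪ tree w d B))                ∎
      where
      open ≤-Reasoning
      rearrange : ∀ h s i → h + (suc s + i) ≡ suc (h + i + s)
      rearrange = solve-∀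

-- Placing forests in gadgets

module Placement {V : Set} (E : ℕ → ℕ → Set) where

  open PermutationSolver V

  Realised : List (V × ℕ) → V → V → Set
  Realised M u v = ∃[ i ] ∃[ j ] ((u , i) ∈ M × (v , j) ∈ M × E i j)

  Realised-mono : ∀ {M N u v} → M ⊆ N → Realised M u v → Realised N u v
  Realised-mono M⊆N (i , j , ui , vj , e) = i , j , M⊆N ui , M⊆N vj , e

  -- ρ lists the vertices that already have a position; the labels ls are put
  -- at distinct positions in [lo, hi).
  record Placed (ρ : List (V × ℕ)) (ls : List V) (es : List (V × V)) (lo hi : ℕ) : Set where
    field
      sites    : List (V × ℕ)
      labelled : map proj₁ sites ↭ ls
      distinct : AllPairs (λ s t → proj₂ s ≢ proj₂ t) sites
      inside   : All (λ s → lo ≤ proj₂ s × proj₂ s < hi) sites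
      realised : ∀ {u v} → (u , v) ∈ es → Realised (ρ ++ sites) u v

  open Placed

  nothing : ∀ {ρ lo hi} → Placed ρ [] [] lo hi
  nothing = record { sites = []; labelled = ↭-refl; distinct = []; inside = []; realised = λ () }

  link : ∀ {ρ u v i j lo hi} → (u , i) ∈ ρ → (v , j) ∈ ρ → E i j → Placed ρ [] [ u , v ] lo hi
  link ui vj e = record
    { sites = []; labelled = ↭-refl; distinct = []; inside = []
    ; realised = λ { (here refl) → _ , _ , ∈-++⁺ˡ ui , ∈-++⁺ˡ vj , e } }

  widen : ∀ {ρ ls es lo lo′ hi hi′} → lo′ ≤ lo → hi ≤ hi′ → Placed ρ ls es lo hi → Placed ρ ls es lo′ hi′
  widen lo′≤lo hi≤hi′ P = record
    { Placed P
    ; inside = All.map (λ (lo≤i , i<hi) → ≤-trans lo′≤lo lo≤i , <-≤-trans i<hi hi≤hi′) (inside P) }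

  reshape : ∀ {ρ ls ls′ es es′ lo hi} → ls′ ↭ ls → es′ ↭ es → Placed ρ ls es lo hi → Placed ρ ls′ es′ lo hi
  reshape ls′↭ls es′↭es P = record
    { Placed P
    ; labelled = ↭-trans (labelled P) (↭-sym ls′↭ls)
    ; realised = realised P ∘ ∈-resp-↭ es′↭es }

  separated : ∀ {lo hi lo′ hi′} {S T : List (V × ℕ)} → hi ≤ lo′ →
              All (λ s → lo ≤ proj₂ s × proj₂ s < hi) S → All (λ s → lo′ ≤ proj₂ s × proj₂ s < hi′) T →
              All (λ s → All (λ t → proj₂ s ≢ proj₂ t) T) S
  separated hi≤lo′ S T =
    All.map (λ (_ , s<hi) → All.map (λ (lo′≤t , _) → <⇒≢ (<-≤-trans s<hi (≤-trans hi≤lo′ lo′≤t))) T) S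

  join : ∀ {ρ ls₁ ls₂ es₁ es₂ lo mid hi} → lo ≤ mid → mid ≤ hi →
         Placed ρ ls₁ es₁ lo mid → Placed ρ ls₂ es₂ mid hi → Placed ρ (ls₁ ++ ls₂) (es₁ ++ es₂) lo hi
  join {ρ} {es₁ = es₁} lo≤mid mid≤hi P Q = record
    { sites    = sites P ++ sites Q
    ; labelled = ↭-trans (↭-reflexive (map-++ proj₁ (sites P) (sites Q))) (Perm.++⁺ (labelled P) (labelled Q))
    ; distinct = AllPairs.++⁺ (distinct P) (distinct Q) (separated ≤-refl (inside P) (inside Q))
    ; inside   = All.++⁺ (inside (widen ≤-refl mid≤hi P)) (inside (widen lo≤mid ≤-refl Q))
    ; realised = λ e∈ → [ Realised-mono (⊆.++⁺ʳ ρ (⊆.xs⊆xs++ys _ _)) ∘ realised P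
                        , Realised-mono (⊆.++⁺ʳ ρ (⊆.xs⊆ys++xs _ (sites P))) ∘ realised Q ]′ (∈-++⁻ es₁ e∈) }

  -- Both sides are placed with v already known at b, so each may realise edges at v; their
  -- intervals leave out b itself.
  place : ∀ {ρ ls₁ ls₂ es₁ es₂ lo hi} v b → lo ≤ b → b < hi →
          Placed ((v , b) ∷ ρ) ls₁ es₁ lo b → Placed ((v , b) ∷ ρ) ls₂ es₂ (suc b) hi →
          Placed ρ (v ∷ ls₁ ++ ls₂) (es₁ ++ es₂) lo hi
  place {ρ} {es₁ = es₁} v b lo≤b b<hi P Q = record
    { sites    = (v , b) ∷ sites P ++ sites Q
    ; labelled = ↭-prep v (↭-trans (↭-reflexive (map-++ proj₁ (sites P) (sites Q)))
                                   (Perm.++⁺ (labelled P) (labelled Q)))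
    ; distinct = All.++⁺ (All.map (λ (_ , i<b) → >⇒≢ i<b) (inside P))
                         (All.map (λ (b<i , _) → <⇒≢ b<i) (inside Q))
                 ∷ AllPairs.++⁺ (distinct P) (distinct Q) (separated (n≤1+n b) (inside P) (inside Q))
    ; inside   = (lo≤b , b<hi) ∷ All.++⁺ (inside (widen ≤-refl (<⇒≤ b<hi) P))
                                         (inside (widen (m≤n⇒m≤1+n lo≤b) ≤-refl Q))
    ; realised = λ e∈ → [ Realised-mono (move (⊆.xs⊆xs++ys _ _)) ∘ realised P
                        , Realised-mono (move (⊆.xs⊆ys++xs _ (sites P))) ∘ realised Q ]′ (∈-++⁻ es₁ e∈) }
    where
    move : ∀ {S T} → S ⊆ T → (v , b) ∷ ρ ++ S ⊆ ρ ++ (v , b) ∷ T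
    move S⊆T (here refl) = ∈-++⁺ʳ ρ (here refl)
    move S⊆T (there s∈)  = ⊆.++⁺ʳ ρ (there ∘ S⊆T) s∈

  -- Only an inclusion into the ambient relation `E`, so a piece inside a larger gadget is embedded
  -- without translating its edges.
  Drawn : Gadget → ℕ → Set
  Drawn g a = ∀ {u v} → Chord g a u v → E u v

  shifted≤ : ∀ {X Y} a → X ≼ Y → a + width X ≤ a + width Y
  shifted≤ a p = +-monoʳ-≤ a (≼-width p)

  apex< : ∀ a l r → a + width l < a + width (tri l r)
  apex< a l r = +-monoʳ-< a (m<m+n (width l) (0<width r))

  beyond-apex≤ : ∀ a l {r X} → X ≼ r → a + width l + width X ≤ a + width (tri l r)
  beyond-apex≤ a l {r} p = ≤-trans (shifted≤ (a + width l) p) (≤-reflexive (+-assoc a (width l) (width r)))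

  -- Embedding by recursion on the level

  mutual
    -- The interval starts at the right end of `X`, which a forest placed inside `X` leaves free;
    -- pieces stacked at one vertex thus occupy disjoint intervals.
    embed-bush : ∀ k X a {ρ} p F → Drawn (bush k X) a → size F < 2 ^ k → (p , a) ∈ ρ →
                 Placed ρ (labels F) (edges p F) (a + width X) (a + width (bush k X))
    embed-bush zero    X a p ∅            D F<       p∈ = nothing
    embed-bush zero    X a p (tree _ _ _) D (s≤s ()) p∈
    embed-bush (suc k) X a p F            D F<       p∈ with splitAt (2 ^ k) F (m^n>0 2 k)
    ... | fits F<h = widen ≤-refl (shifted≤ a X₁≼) (embed-bush k X a p F (D ∘ ≼-Chord X₁≼) F<h p∈)
      where
      X₁≼ : bush k X ≼ bush (suc k) X
      X₁≼ = ≼-tri (≼-trans (≼-fan k _) (≼-strip k _))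
    ... | split A v c B A<h h≤ with suc (size c) <? 2 ^ k
    ...   | yes c<h = embed-around k X a p A v c B D A<h (split-rest< A v c B h≤ F<) p∈
      (≼-trans (≼-bush k _) (≼-bush k _))
      (embed-bush k edge _ v c (D ∘ right ∘ ≼-Chord (≼-trans (≼-bush k _) (≼-bush k _)))
        (<-trans (n<1+n _) c<h) (here refl))
    ...   | no  c≮h = embed-heavy k X a p A v c B D F< (≮⇒≥ c≮h) p∈

    -- The tree at v takes at least half of the weight bound, so `A ∪ B` is light; the subtree at
    -- `end` does too, so `inner` is light and fits into the strip between p and the apex.
    embed-heavy : ∀ k X a {ρ} p A v c B → Drawn (bush (suc k) X) a →
                  size (A ∪ tree v c B) < 2 ^ suc k → 2 ^ k ≤ suc (size c) → (p , a) ∈ ρ →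
                  Placed ρ (labels (A ∪ tree v c B)) (edges p (A ∪ tree v c B))
                         (a + width X) (a + width (bush (suc k) X))
    embed-heavy k X a {ρ} p A v c B D F< h≤c p∈ =
      reshape labels-heavy edges-heavy
        (place end b (shifted≤ a (≼-trans (≼-bush k X) X₁≼L)) (apex< a L R)
          (join (shifted≤ a (≼-bush k X)) (shifted≤ a X₁≼L)
            (embed-bush k X a p (A ∪ B) (D ∘ ≼-Chord (≼-tri X₁≼L)) A∪B<h (there p∈))
            (widen (shifted≤ a (≼-fan k (bush k X))) ≤-refl
              (embed-strip k (fan k (bush k X)) a p inner end (D ∘ left) inner<h (there p∈) (here refl))))
          -- The right-hand bushes start from `edge`, of width 1, which keeps them off the apex
          -- corner b.
          (widen (≤-reflexive (+-comm 1 b)) (beyond-apex≤ a L {R} ≼-refl)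
            (join (shifted≤ b (≼-bush k edge)) (shifted≤ b R₁≼R)
              (embed-bush k edge b end d₁ (D ∘ right ∘ ≼-Chord R₁≼R) d₁<h (here refl))
              (join (shifted≤ b (≼-bush k (bush k edge))) (shifted≤ b (≼-bush k (bush k (bush k edge))))
                (embed-bush k (bush k edge) b end d₂ (D ∘ right ∘ ≼-Chord (≼-bush k _)) d₂<h (here refl))
                (embed-bush k (bush k (bush k edge)) b end d₃ (D ∘ right) d₃<h (here refl))))))
      where
      L R : Gadget
      L = strip k (fan k (bush k X))
      R = bush k (bush k (bush k edge))
      b : ℕ
      b = a + width L
      X₁≼L : bush k X ≼ L
      X₁≼L = ≼-trans (≼-fan k _) (≼-strip k _)
      R₁≼R : bush k edge ≼ R
      R₁≼R = ≼-trans (≼-bush k _) (≼-bush k _)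
      c<F : suc (size c) ≤ size (A ∪ tree v c B)
      c<F = child< A v c B
      open HeavyPath (heavyPath (suc (size c)) v c (n<1+n _) h≤c (≤-<-trans c<F F<))
      A∪B<h : size (A ∪ B) < 2 ^ k
      A∪B<h = subst (_< 2 ^ k) (sym (size-∪ A B)) (remainder< _ h≤c (size-split A v c B) F<)
      inner<h : size inner < 2 ^ k
      inner<h = remainder< (2 ^ k) ≤-refl refl (≤-<-trans inner≤ (≤-<-trans c<F F<))
      labels-heavy : labels (A ∪ tree v c B) ↭
        end ∷ (labels (A ∪ B) ++ labels inner) ++ labels d₁ ++ labels d₂ ++ labels d₃
      labels-heavy rewrite labels-∪ A B = ↭-trans (labels-split A v c B) (↭-trans
        (solveᵛ 3 (λ v ab c → (v ⊕ᵛ ab ⊕ᵛ c) ⊜ᵛ (ab ⊕ᵛ (v ⊕ᵛ c)))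
          ↭-refl [ v ] (labels A ++ labels B) (labels c)) (↭-trans
        (Perm.++⁺ˡ (labels A ++ labels B) labels-↭)
        (solveᵛ 4 (λ ab e i d → (ab ⊕ᵛ (e ⊕ᵛ i ⊕ᵛ d)) ⊜ᵛ (e ⊕ᵛ (ab ⊕ᵛ i) ⊕ᵛ d))
          ↭-refl (labels A ++ labels B) [ end ] (labels inner) _)))
      edges-heavy : edges p (A ∪ tree v c B) ↭
        (edges p (A ∪ B) ++ spine p inner end) ++ edges end d₁ ++ edges end d₂ ++ edges end d₃
      edges-heavy rewrite edges-∪ p A B = ↭-trans (edges-split p A v c B) (↭-trans
        (solveᵉ 3 (λ v ab c → (v ⊕ᵉ ab ⊕ᵉ c) ⊜ᵉ (ab ⊕ᵉ (v ⊕ᵉ c)))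
          ↭-refl [ p , v ] (edges p A ++ edges p B) (edges v c)) (↭-trans
        (Perm.++⁺ˡ (edges p A ++ edges p B) (edges-↭ p))
        (↭-reflexive (sym (++-assoc (edges p A ++ edges p B) (spine p inner end) _)))))

    -- `bush (suc k) X` and `strip (suc k) (fan (suc k) X)` have the same left side l, so one
    -- argument serves both. They differ in the bush that takes c at the apex, hence the argument
    -- `below`.
    embed-around : ∀ k X a {ρ} p A v c B {r s} → let l = strip k (fan k (bush k X)) in
                   Drawn (tri l r) a → size A < 2 ^ k → size B < 2 ^ k → (p , a) ∈ ρ → s ≼ r →
                   Placed ((v , a + width l) ∷ ρ) (labels c) (edges v c)
                          (a + width l + 1) (a + width l + width s) →
                   Placed ρ (labels (A ∪ tree v c B)) (edges p (A ∪ tree v c B))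
                          (a + width X) (a + width (tri l r))
    embed-around k X a p A v c B {r} D A<h B<h p∈ s≼r below =
      reshape (labels-split A v c B) (edges-split p A v c B)
        (place v b (shifted≤ a (≼-trans (≼-bush k X) X₁≼l)) (apex< a l r)
          (join ≤-refl (shifted≤ a (≼-trans (≼-bush k X) X₁≼l))
            -- The edge from p to v is the base of the left side.
            (link (there p∈) (here refl) (D (left (base refl))))
            (join (shifted≤ a (≼-bush k X)) (shifted≤ a X₁≼l)
              (embed-bush k X a p A (D ∘ ≼-Chord (≼-tri X₁≼l)) A<h (there p∈))
              (embed-fan k (bush k X) a p B (D ∘ left) B<h (there p∈))))
          (widen (≤-reflexive (+-comm 1 b)) (beyond-apex≤ a l s≼r) below))
      where
      l : Gadget
      l = strip k (fan k (bush k X))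
      b : ℕ
      b = a + width l
      X₁≼l : bush k X ≼ l
      X₁≼l = ≼-trans (≼-fan k _) (≼-strip k _)

    -- The strip's apex can host the root at the cut, and since that apex carries `bush (suc k)`,
    -- the tree there may be heavy without a separate case.
    embed-fan : ∀ k X a {ρ} p F → Drawn (strip k (fan k X)) a → size F < 2 ^ k → (p , a) ∈ ρ →
                Placed ρ (labels F) (edges p F) (a + width X) (a + width (strip k (fan k X)))
    embed-fan zero    X a p ∅            D F<       p∈ = nothing
    embed-fan zero    X a p (tree _ _ _) D (s≤s ()) p∈
    embed-fan (suc k) X a p F            D F<       p∈ with splitAt (2 ^ k) F (m^n>0 2 k)
    ... | fits F<h = widen (shifted≤ a (≼-bush k X)) (<⇒≤ (apex< a (strip k (fan k (bush k X))) (strip k (bush (suc k) edge))))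
                       (embed-fan k (bush k X) a p F (D ∘ left) F<h p∈)
    ... | split A v c B A<h h≤ = embed-around k X a p A v c B D A<h (split-rest< A v c B h≤ F<) p∈
      (≼-strip k _)
      (embed-bush (suc k) edge _ v c (D ∘ right ∘ ≼-Chord (≼-strip k _))
        (<-trans (child< A v c B) F<) (here refl))

    embed-strip : ∀ k X a {ρ} p F q → Drawn (strip k X) a → size F < 2 ^ k →
                  (p , a) ∈ ρ → (q , a + width (strip k X)) ∈ ρ →
                  Placed ρ (labels F) (spine p F q) (a + width X) (a + width (strip k X))
    -- A path without inner vertices is the base chord itself.
    embed-strip k       X a p ∅            q D F<       p∈ q∈ = link p∈ q∈ (D (base refl))
    embed-strip zero    X a p (tree _ _ _) q D (s≤s ()) p∈ q∈
    embed-strip (suc k) X a p F@(tree _ _ _) q D F<   p∈ q∈ with centre (2 ^ k) F (λ ()) F<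
    ... | A , v , c , B , eq , A<h , B<h , c<2h =
      subst (λ F → Placed _ (labels F) (spine p F q) _ _) (sym eq)
        (embed-strip-at k X a p A v c B q D A<h B<h p∈ q∈
          (embed-bush (suc k) edge _ v c (D ∘ right ∘ ≼-Chord (≼-strip k _)) c<2h (here refl)))

    embed-strip-at : ∀ k X a {ρ} p A v c B q → Drawn (strip (suc k) X) a →
                     size A < 2 ^ k → size B < 2 ^ k →
                     (p , a) ∈ ρ → (q , a + width (strip (suc k) X)) ∈ ρ →
                     let b = a + width (strip k X) in
                     Placed ((v , b) ∷ ρ) (labels c) (edges v c) (b + 1) (b + width (bush (suc k) edge)) →
                     Placed ρ (labels (A ∪ tree v c B)) (spine p (A ∪ tree v c B) q)
                            (a + width X) (a + width (strip (suc k) X))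
    embed-strip-at k X a {ρ} p A v c B q D A<h B<h p∈ q∈ below =
      reshape (↭-trans (↭-reflexive (labels-∪ A (tree v c B))) (Perm.shift v (labels A) _))
              (↭-reflexive (spine-∪ p A v c B q))
        (place v b (shifted≤ a (≼-strip k X)) (apex< a l r)
          (embed-strip k X a p A v (D ∘ left) A<h (there p∈) (here refl))
          (widen (≤-reflexive (+-comm 1 b)) (beyond-apex≤ a l {r} ≼-refl)
            (join (shifted≤ b (≼-bush (suc k) edge)) (shifted≤ b (≼-strip k (bush (suc k) edge)))
              below
              (embed-strip k (bush (suc k) edge) b v B q (D ∘ right) B<h (here refl)
                (there (subst (λ i → (q , i) ∈ ρ) (sym (+-assoc a (width l) (width r))) q∈))))))
      where
      l r : Gadget
      l = strip k X
      r = strip k (bush (suc k) edge)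
      b : ℕ
      b = a + width l

-- Walks and cycles

module _ {n} {G : SimpleGraph n} where

  Reach-trans : ∀ {u v w} → Reach G u v → Reach G v w → Reach G u w
  Reach-trans here        q = q
  Reach-trans (step uv p) q = step uv (Reach-trans p q)

  Reach-sym : ∀ {u v} → Reach G u v → Reach G v u
  Reach-sym here        = here
  Reach-sym (step uv p) = Reach-trans (Reach-sym p) (step (Adj-sym G uv) here)

data Path {n} (G : SimpleGraph n) : Fin n → Fin n → List (Fin n) → Set where
  stop : ∀ {u} → Path G u u [ u ]
  move : ∀ {u v w l} → Adj G u v → Path G v w l → Path G u w (u ∷ l)

module _ {n} {G : SimpleGraph n} where

  open DecMembership (Fin._≟_ {n}) using (_∈?_)

  suffix : ∀ {u v w l} → Path G v w l → Unique l → u ∈ l → ∃[ l′ ] (Path G u w l′ × Unique l′)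
  suffix p          uniq       (here refl) with p
  ... | stop     = _ , stop , uniq
  ... | move e q = _ , move e q , uniq
  suffix (move _ p) (_ ∷ uniq) (there u∈)  = suffix p uniq u∈

  -- Loop erasure: if u already lies on the simple path from its successor, restart from that
  -- occurrence.
  simplify : ∀ {u v} → Reach G u v → ∃[ l ] (Path G u v l × Unique l)
  simplify here = _ , stop , [] ∷ []
  simplify {u} (step uw r) with simplify r
  ... | l , p , uniq with u ∈? l
  ...   | yes u∈l = suffix p uniq u∈l
  ...   | no  u∉l = u ∷ l , move uw p , All.¬Any⇒All¬ l u∉l ∷ uniq

  path-steps : ∀ {u w x l} → Path G u w (x ∷ l) → (i : Fin (length l)) →
               Adj G (lookup (x ∷ l) (inject₁ i)) (lookup (x ∷ l) (suc i))
  path-steps (move e stop)       zero    = e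
  path-steps (move e (move _ _)) zero    = e
  path-steps (move e p@(move _ _)) (suc i) = path-steps p i

  path-last : ∀ {u w x l} → Path G u w (x ∷ l) → lookup (x ∷ l) (fromℕ (length l)) ≡ w
  path-last stop                  = refl
  path-last (move e stop)         = refl
  path-last (move e p@(move _ _)) = path-last p

pairwise≢⇒injective : ∀ {A B : Set} {f : A → B} {xs} → AllPairs (λ x y → f x ≢ f y) xs →
                      ∀ {x y} → x ∈ xs → y ∈ xs → f x ≡ f y → x ≡ y
pairwise≢⇒injective (_   ∷ _)  (here refl) (here refl) _  = refl
pairwise≢⇒injective (f≢  ∷ _)  (here refl) (there y∈)  eq = contradiction eq (All.lookup f≢ y∈)
pairwise≢⇒injective (f≢  ∷ _)  (there x∈)  (here refl) eq = contradiction (sym eq) (All.lookup f≢ x∈)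
pairwise≢⇒injective (_   ∷ ap) (there x∈)  (there y∈)  eq = pairwise≢⇒injective ap x∈ y∈ eq

Unique⇒lookup-injective : ∀ {A : Set} {xs : List A} → Unique xs → Injective _≡_ _≡_ (lookup xs)
Unique⇒lookup-injective (_  ∷ _)    {zero}  {zero}  _  = refl
Unique⇒lookup-injective (x≢ ∷ _)    {zero}  {suc j} eq = contradiction eq (All.lookup x≢ (∈-lookup j))
Unique⇒lookup-injective (x≢ ∷ _)    {suc i} {zero}  eq = contradiction (sym eq) (All.lookup x≢ (∈-lookup i))
Unique⇒lookup-injective (_  ∷ uniq) {suc i} {suc j} eq = cong suc (Unique⇒lookup-injective uniq eq)

-- A simple path from u to v in S has at least three vertices: one would make uv a loop, two would
-- put uv in S. The edge vu closes it.
closing-edge-cycle : ∀ {n} (G S : SimpleGraph n) → (∀ {x y} → Adj S x y → Adj G x y) →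
                     ∀ {u v} → Reach S u v → Adj G u v → ¬ Adj S u v → HasCycle G
closing-edge-cycle G S S⊆G r uv ¬uv with simplify r
... | _ , stop , _                      = contradiction uv (irrefl G)
... | _ , move e stop , _               = contradiction e ¬uv
... | x ∷ y ∷ z ∷ l , p@(move _ (move _ q)) , uniq =
  length l , lookup (x ∷ y ∷ z ∷ l) , Unique⇒lookup-injective uniq ,
  (λ i → S⊆G (path-steps p i)) ,
  subst₂ (Adj G) (sym (path-last p)) refl (Adj-sym G uv)

-- Spanning trees

module _ {V : Set} where

  -- The new leaf v becomes the first child of u.
  graft : ∀ p F (u v : V) → u ∈ p ∷ labels F →
          ∃[ F′ ] (labels F′ ↭ v ∷ labels F × edges p F′ ↭ (u , v) ∷ edges p F)
  graft p F            u v (here refl) = tree v ∅ F , ↭-refl , ↭-refl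
  graft p (tree w c F) u v (there u∈) with ∈-++⁻ (w ∷ labels c) u∈
  ... | inj₁ u∈c with graft w c u v u∈c
  ...   | c′ , ls , es = tree w c′ F
    , ↭-trans (↭-prep w (Perm.++⁺ʳ (labels F) ls)) (↭-swap w v ↭-refl)
    , ↭-trans (↭-prep (p , w) (Perm.++⁺ʳ (edges p F) es)) (↭-swap (p , w) (u , v) ↭-refl)
  graft p (tree w c F) u v (there u∈) | inj₂ u∈F with graft p F u v (there u∈F)
  ... | F′ , ls , es = tree w c F′
    , ↭-trans (↭-prep w (Perm.++⁺ˡ (labels c) ls)) (Perm.shift v (w ∷ labels c) (labels F))
    , ↭-trans (↭-prep (p , w) (Perm.++⁺ˡ (edges w c) es))
              (Perm.shift (u , v) ((p , w) ∷ edges w c) (edges p F))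

  length-labels : ∀ (F : Forest {V}) → length (labels F) ≡ size F
  length-labels ∅            = refl
  length-labels (tree v c F) = cong suc (trans (length-++ (labels c))
                                               (cong₂ _+_ (length-labels c) (length-labels F)))

module _ {n} (T : SimpleGraph n) (r : Fin n) where

  open DecMembership (Fin._≟_ {n}) using (_∈?_)

  record Subtree (F : Forest) : Set where
    field
      unique : Unique (r ∷ labels F)
      sound  : ∀ {u v} → (u , v) ∈ edges r F → Adj T u v
  open Subtree public

  Extension : Forest → (Forest → Set) → Set
  Extension F P = ∃[ F′ ] (Subtree F′ × r ∷ labels F ⊆ r ∷ labels F′ × P F′)

  extend : ∀ {F u v} → Subtree F → u ∈ r ∷ labels F → ¬ v ∈ r ∷ labels F → Adj T u v →
           Extension F (λ F′ → v ∈ r ∷ labels F′)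
  extend {F} {u} {v} S u∈ v∉ uv with graft r F u v u∈
  ... | F′ , ls , es = F′
    , record
      { unique = PermSetoid.Unique-resp-↭ (setoid (Fin n)) (↭⇒↭ₛ (↭-sym ls′)) (All.¬Any⇒All¬ _ v∉ ∷ unique S)
      ; sound  = λ e∈ → sound′ (∈-resp-↭ es e∈) }
    , (λ x∈ → ∈-resp-↭ (↭-sym ls′) (there x∈))
    , ∈-resp-↭ (↭-sym ls′) (here refl)
    where
    ls′ : r ∷ labels F′ ↭ v ∷ r ∷ labels F
    ls′ = ↭-trans (↭-prep r ls) (↭-swap r v ↭-refl)
    sound′ : ∀ {x y} → (x , y) ∈ (u , v) ∷ edges r F → Adj T x y
    sound′ (here refl) = uv
    sound′ (there e∈)  = sound S e∈

  -- Along the walk the current vertex is always in the subtree, so a missing next vertex can be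
  -- grafted by the edge just walked.
  cover : ∀ {F u x} → Subtree F → u ∈ r ∷ labels F → Reach T u x →
          Extension F (λ F′ → x ∈ r ∷ labels F′)
  cover {F} S u∈ here = F , S , id , u∈
  cover {F} S u∈ (step {v = v} uv p) with v ∈? r ∷ labels F
  ... | yes v∈ = cover S v∈ p
  ... | no  v∉ with extend S u∈ v∉ uv
  ...   | F₁ , S₁ , F⊆F₁ , v∈ with cover S₁ v∈ p
  ...     | F₂ , S₂ , F₁⊆F₂ , x∈ = F₂ , S₂ , F₁⊆F₂ ∘ F⊆F₁ , x∈

  coverAll : ∀ {F} (xs : List (Fin n)) → Connected T → Subtree F →
             Extension F (λ F′ → All (_∈ r ∷ labels F′) xs)
  coverAll {F} []       conn S = F , S , id , []
  coverAll     (x ∷ xs) conn S with cover S (here refl) (conn r x)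
  ... | F₁ , S₁ , F⊆F₁ , x∈ with coverAll xs conn S₁
  ...   | F₂ , S₂ , F₁⊆F₂ , xs∈ = F₂ , S₂ , F₁⊆F₂ ∘ F⊆F₁ , F₁⊆F₂ x∈ ∷ xs∈

  spanningTree : Connected T → ∃[ F ] (Subtree F × (∀ x → x ∈ r ∷ labels F))
  spanningTree conn with coverAll {∅} (allFin n) conn (record { unique = [] ∷ []; sound = λ () })
  ... | F , S , _ , all∈ = F , S , λ x → All.lookup all∈ (∈-allFin x)

  size-subtree : ∀ {F} → Subtree F → size F < n
  size-subtree {F} S = subst (λ s → suc s ≤ n) (length-labels F)
    (injective⇒≤ (Unique⇒lookup-injective (unique S)))

  treeGraph : ∀ {F} → Subtree F → SimpleGraph n
  treeGraph {F} S = record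
    { Adj    = λ u v → (u , v) ∈ edges r F ⊎ (v , u) ∈ edges r F
    ; sym    = swap
    ; irrefl = λ e → irrefl T ([ sound S , sound S ]′ e) }

  treeGraph-Reach : ∀ {F} (S : Subtree F) p G → edges p G ⊆ edges r F →
                    ∀ {x} → x ∈ p ∷ labels G → Reach (treeGraph S) p x
  treeGraph-Reach S p G            G⊆F (here refl) = here
  treeGraph-Reach S p (tree v c G) G⊆F (there x∈) with ∈-++⁻ (v ∷ labels c) x∈
  ... | inj₁ x∈c = step (inj₁ (G⊆F (here refl))) (treeGraph-Reach S v c (G⊆F ∘ there ∘ ∈-++⁺ˡ) x∈c)
  ... | inj₂ x∈G = treeGraph-Reach S p G (G⊆F ∘ there ∘ ∈-++⁺ʳ (edges v c)) (there x∈G)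

  -- An edge of `T` outside the spanning tree would form a cycle with the tree walk between its ends
  -- through r.
  tree-edge : ∀ {F} (S : Subtree F) → (∀ x → x ∈ r ∷ labels F) → Acyclic T →
              ∀ {u v} → Adj T u v → Adj (treeGraph S) u v
  tree-edge {F} S all∈ acyclic {u} {v} uv with (u , v) ∈ᵉ? edges r F ⊎-dec (v , u) ∈ᵉ? edges r F
    where open DecMembership (≡-dec (Fin._≟_ {n}) (Fin._≟_ {n})) using () renaming (_∈?_ to _∈ᵉ?_)
  ... | yes e = e
  ... | no ¬e = contradiction
    (closing-edge-cycle T (treeGraph S) [ sound S , Adj-sym T ∘ sound S ]′
      (Reach-trans (Reach-sym (reach u)) (reach v)) uv ¬e)
    acyclic
    where
    reach : ∀ x → Reach (treeGraph S) r x
    reach x = treeGraph-Reach S r F id (all∈ x)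

-- The universal graph

chordGraph : (g : Gadget) → SimpleGraph (suc (width g))
chordGraph g = record
  { Adj    = λ i j → Chord g 0 (toℕ i) (toℕ j) ⊎ Chord g 0 (toℕ j) (toℕ i)
  ; sym    = swap
  ; irrefl = λ c → n≮n _ ([ Chord-increasing , Chord-increasing ]′ c) }

chordGraph-outerplanar : ∀ g → Outerplanar (chordGraph g)
chordGraph-outerplanar g = id , id , λ u v x y uv xy (u<x , x<v , v<y) →
  Chord-noncrossing (orient uv (<-trans u<x x<v)) (orient xy (<-trans x<v v<y)) u<x x<v v<y
  where
  orient : ∀ {i j} → Adj (chordGraph g) i j → toℕ i < toℕ j → Chord g 0 (toℕ i) (toℕ j)
  orient (inj₁ c) _   = c
  orient (inj₂ c) i<j = contradiction (Chord-increasing c) (<⇒≯ i<j)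

bush-universal : ∀ k {n} (T : SimpleGraph (suc n)) → suc n ≤ 2 ^ k → IsTree T →
                 Contains (chordGraph (bush k edge)) T
bush-universal k {n} T n≤2^k (conn , acyclic) with spanningTree T zero conn
... | F , S , all∈ = f , f-injective , λ u v uv →
  [ f-edge , swap ∘ f-edge ]′ (tree-edge T zero S all∈ acyclic uv)
  where
  g = bush k edge
  open Placement {Fin (suc n)} (Chord g 0)
  open Placed (embed-bush k edge 0 zero F id (<-≤-trans (size-subtree T zero S) n≤2^k) (here {xs = []} refl))
  M : List (Fin (suc n) × ℕ)
  M = (zero , 0) ∷ sites
  distinct-positions : AllPairs (λ s t → proj₂ s ≢ proj₂ t) M
  -- The sites start at `width edge`, that is 1, so corner 0 is free for the root.
  distinct-positions = All.map (λ (1≤i , _) → <⇒≢ 1≤i) inside ∷ distinct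
  distinct-labels : AllPairs (λ s t → proj₁ s ≢ proj₁ t) M
  distinct-labels = AllPairs.map⁻
    (PermSetoid.Unique-resp-↭ (setoid _) (↭⇒↭ₛ (↭-prep zero (↭-sym labelled))) (unique S))
  in-range : ∀ {x i} → (x , i) ∈ M → i < suc (width g)
  in-range (here refl) = z<s
  in-range (there s∈)  = m<n⇒m<1+n (proj₂ (All.lookup inside s∈))
  locate : ∀ x → ∃[ i ] (x , i) ∈ M
  locate x with ∈-map⁻ proj₁ (∈-resp-↭ (↭-prep zero (↭-sym labelled)) (all∈ x))
  ... | (_ , i) , s∈ , refl = i , s∈
  f : Fin (suc n) → Fin (suc (width g))
  f x = fromℕ< (in-range (proj₂ (locate x)))
  f-injective : Injective _≡_ _≡_ f
  f-injective {x} {y} eq = ,-injectiveˡ (pairwise≢⇒injective distinct-positions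
    (proj₂ (locate x)) (proj₂ (locate y)) (fromℕ<-injective _ _ _ _ eq))
  -- Labels are distinct, so the sites supplied by `realised` are those that `locate` chose.
  f-position : ∀ {x i} → (x , i) ∈ M → i ≡ toℕ (f x)
  f-position {x} s∈ = trans
    (cong proj₂ (pairwise≢⇒injective distinct-labels s∈ (proj₂ (locate x)) refl))
    (sym (toℕ-fromℕ< _))
  f-edge : ∀ {u v} → (u , v) ∈ edges zero F → Adj (chordGraph g) (f u) (f v)
  f-edge e∈ with realised e∈
  ... | i , j , ui , vj , c = inj₁ (subst₂ (Chord g 0) (f-position ui) (f-position vj) c)

-- The size of the universal graph

-- An integral form of 6 < 3 + √10: with √10 lowered to 3, each step still multiplies by at least 6.
6^q≤A+3B : ∀ q → 6 ^ q ≤ Defs.A q + 3 * Defs.B q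
6^q≤A+3B zero    = ≤-refl
6^q≤A+3B (suc q) = begin
  6 * 6 ^ q                              ≤⟨ *-monoʳ-≤ 6 (6^q≤A+3B q) ⟩
  6 * (a + 3 * b)                        ≤⟨ m≤m+n _ b ⟩
  6 * (a + 3 * b) + b                    ≡⟨ rearrange a b ⟩
  (3 * a + 10 * b) + 3 * (a + 3 * b)     ∎
  where
  open ≤-Reasoning
  a = Defs.A q
  b = Defs.B q
  rearrange : ∀ a b → 6 * (a + 3 * b) + b ≡ (3 * a + 10 * b) + 3 * (a + 3 * b)
  rearrange = solve-∀

^-distribʳ-* : ∀ k m n → (m * n) ^ k ≡ m ^ k * n ^ k
^-distribʳ-* zero    m n = refl
^-distribʳ-* (suc k) m n = trans (cong (m * n *_) (^-distribʳ-* k m n)) ([m*n]*[o*p]≡[m*o]*[n*p] m n (m ^ k) (n ^ k))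

-- From 9b² ≤ 10b², the difference `2 ^ p ∸ a` exceeds 3b as well.
AboveC⇒6^q≤2^p : ∀ {p q} → AboveC p q → 6 ^ q ≤ 2 ^ p
AboveC⇒6^q≤2^p {p} {q} (a<2^p , 10b²<) = begin
  6 ^ q                 ≤⟨ 6^q≤A+3B q ⟩
  a + 3 * b             ≤⟨ +-monoʳ-≤ a (<⇒≤ 3b<) ⟩
  a + (2 ^ p ∸ a)       ≡⟨ m+[n∸m]≡n (<⇒≤ a<2^p) ⟩
  2 ^ p                 ∎
  where
  open ≤-Reasoning
  a = Defs.A q
  b = Defs.B q
  [3b]²≤10b² : (3 * b) ^ 2 ≤ 10 * b ^ 2
  [3b]²≤10b² = ≤-trans (≤-reflexive (^-distribʳ-* 2 3 b)) (*-monoˡ-≤ (b ^ 2) (n≤1+n 9))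
  3b< : 3 * b < 2 ^ p ∸ a
  3b< = ≰⇒> λ ≥ → <⇒≱ 10b²< (≤-trans (^-monoˡ-≤ 2 ≥) [3b]²≤10b²)

-- The exponent k makes the host large enough, while j charges its size to n; the gap costs at most
-- one factor 6.
sandwich : ∀ n → ∃[ k ] ∃[ j ] (suc n ≤ 2 ^ k × k ≤ suc j × 2 ^ j ≤ suc n)
sandwich zero    = 0 , 0 , ≤-refl , z≤n , ≤-refl
sandwich (suc n) with sandwich n
... | k , j , n≤2^k , k≤1+j , 2^j≤n with 2 + n ≤? 2 ^ k
...   | yes n+1≤2^k = k , j , n+1≤2^k , k≤1+j , m≤n⇒m≤1+n 2^j≤n
-- The order has just outgrown `2 ^ k`, which now serves as the lower bound.
...   | no  n+1≰2^k = suc k , k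
  , ≤-trans (s≤s n≤2^k) (^-monoʳ-< 2 ≤-refl (n<1+n k))
  , ≤-refl , <⇒≤ (≰⇒> n+1≰2^k)

-- Since 6 ≤ 2^(p/q), also 6^j ≤ (2^j)^(p/q) ≤ n^(p/q). The constant is 42 = 7 * 6: the order is at
-- most 2 + 5 * 6^k ≤ 7 * 6^k, and passing from k to j costs a factor 6.
bush-BoundedBy : ∀ {k j n} → k ≤ suc j → 2 ^ j ≤ n → BoundedBy 42 n (suc (width (bush k edge)))
bush-BoundedBy {k} {j} {n} k≤1+j 2^j≤n p q _ p/q>c = begin
  suc (width (bush k edge)) ^ q  ≤⟨ ^-monoˡ-≤ q order≤ ⟩
  (42 * 6 ^ j) ^ q               ≡⟨ ^-distribʳ-* q 42 (6 ^ j) ⟩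
  42 ^ q * (6 ^ j) ^ q           ≡⟨ cong (42 ^ q *_) (^-swap 6 j q) ⟩
  42 ^ q * (6 ^ q) ^ j           ≤⟨ *-monoʳ-≤ (42 ^ q) (^-monoˡ-≤ j (AboveC⇒6^q≤2^p {p} {q} p/q>c)) ⟩
  42 ^ q * (2 ^ p) ^ j           ≡⟨ cong (42 ^ q *_) (^-swap 2 p j) ⟩
  42 ^ q * (2 ^ j) ^ p           ≤⟨ *-monoʳ-≤ (42 ^ q) (^-monoˡ-≤ p 2^j≤n) ⟩
  42 ^ q * n ^ p                 ∎
  where
  open ≤-Reasoning
  ^-swap : ∀ m i j → (m ^ i) ^ j ≡ (m ^ j) ^ i
  ^-swap m i j = trans (^-*-assoc m i j) (trans (cong (m ^_) (*-comm i j)) (sym (^-*-assoc m j i)))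
  order≤ : suc (width (bush k edge)) ≤ 42 * 6 ^ j
  order≤ = begin
    suc (width (bush k edge))  ≤⟨ s≤s (width-bush k edge) ⟩
    2 + 5 * 6 ^ k              ≤⟨ +-monoˡ-≤ (5 * 6 ^ k) (*-monoʳ-≤ 2 (m^n>0 6 k)) ⟩
    2 * 6 ^ k + 5 * 6 ^ k      ≡⟨ sym (*-distribʳ-+ (6 ^ k) 2 5) ⟩
    7 * 6 ^ k                  ≤⟨ *-monoʳ-≤ 7 (^-monoʳ-≤ 6 k≤1+j) ⟩
    7 * (6 * 6 ^ j)            ≡⟨ sym (*-assoc 7 6 (6 ^ j)) ⟩
    42 * 6 ^ j                 ∎

emptyGraph : SimpleGraph 0
emptyGraph = record { Adj = λ () ; sym = λ { {()} } ; irrefl = λ { {()} } }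

theorem1 : ∃[ C ] (0 < C × ((n : ℕ) → ∃[ m ] Σ (SimpleGraph m) λ H →
    Outerplanar H × BoundedBy C n m ×
    ((T : SimpleGraph n) → IsTree T → Contains H T)))
theorem1 = 42 , z<s , λ where
  zero → 0 , emptyGraph , (id , id , λ ()) , (λ { p (suc q) _ _ → z≤n }) ,
         λ T _ → id , id , λ ()
  (suc n) → let (k , j , n≤2^k , k≤1+j , 2^j≤n) = sandwich n in
    suc (width (bush k edge)) , chordGraph (bush k edge) , chordGraph-outerplanar (bush k edge) ,
    bush-BoundedBy {k} {j} k≤1+j 2^j≤n , λ T → bush-universal k T n≤2^k
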